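{- Let $n\ge 3$ be an integer and let $G$ be a simple graph. Then $G$ is isomorphic to the wheel $W_n$ if and only if all of the following hold: $$[x]\,da(G;x,y) = ny^{n-2}+ y,\qquad [x^{n}]\,da(G;x,y) = (n+1)y^{n+2},\qquad [x^{n+1}]\,da(G;x,y) = y^{n+4}.$$
   Context: All graphs are finite, simple and have at least one vertex. For a graph $G$, $S\subseteq V(G)$ and $u\in V(G)$, let $\bar S=V(G)\setminus S$, let $\delta_S(u)=|\{v\in S:\{u,v\}\in E(G)\}|$, and let $G[S]$ be the subgraph induced by $S$. The defensive alliance polynomial of $G$ is $$da(G;x,y)=\sum_{S} x^{|S|}\,y^{f_y(S)},\qquad f_y(S)=\min_{u\in S}\bigl(\delta_S(u)-\delta_{\bar S}(u)+|V(G)|\bigr),$$ where the sum runs over all non-empty $S\subseteq V(G)$ such that $G[S]$ is connected (single-vertex graphs are connected). $[x^k]\,da(G;x,y)$ denotes the coefficient of $x^k$ in $da(G;x,y)$, which is a polynomial in $y$. The wheel $W_n$ is the graph join $C_n+K_1$, i.e. the cycle $C_n$ together with one extra vertex adjacent to all vertices of the cycle (so it has $n+1$ vertices). -}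

module Defs where

open import Data.Empty using (⊥)
open import Data.Fin.Base using (Fin; zero; suc; toℕ)
open import Data.Fin.Subset using (Subset; inside; outside; _∈_; _∩_; ∁; ∣_∣; Nonempty)
open import Data.Fin.Subset.Properties using (nonempty?; ∣p∣≤n)
open import Data.Integer.Base as ℤ using (+_)
import Data.Integer.Properties as ℤ
open import Data.List.Base using (List; []; _∷_; [_]; _++_; map; filter; foldr; replicate)
open import Data.List.Extrema.Nat using (min)
import Data.List.Membership.Propositional as List
open import Data.List.Membership.Propositional.Properties using (∈-map⁺)
import Data.List.Relation.Unary.All as All
import Data.List.Relation.Unary.Any as Any
open import Data.Nat.Base using (ℕ; zero; suc; _+_; _∸_; _≤_; s≤s; z≤n)
import Data.Nat.Properties as ℕ
open import Data.Product.Base using (∃; _×_; _,_; proj₁; proj₂)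
open import Data.Sum.Base using (_⊎_; inj₁; inj₂; swap)
open import Data.Unit.Base using (⊤; tt)
open import Data.Vec.Base using ([]; _∷_; tabulate; here; there)
open import Function.Base using (_∘_)
open import Function.Bundles using (_↔_; _⇔_; Inverse)
open import Level using (0ℓ)
open import Relation.Binary.Core using (Rel)
open import Relation.Binary.Construct.Closure.ReflexiveTransitive using (Star; ε; _◅_; _◅◅_)
open import Relation.Binary.Definitions using (Symmetric; Decidable)
open import Relation.Binary.PropositionalEquality using (_≡_; refl; sym; trans; cong; module ≡-Reasoning)
open import Relation.Nullary.Decidable using (Dec; yes; no; does; map′; _×-dec_; _⊎-dec_)
open import Relation.Nullary.Negation using (¬_)

record Graph (V : Set) : Set₁ where
  field
    _~_    : Rel V 0ℓ
    _~?_   : Decidable _~_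
    ~-sym  : Symmetric _~_
    ~-irr  : ∀ {v} → ¬ (v ~ v)

record _≅_ {V W : Set} (G : Graph V) (H : Graph W) : Set where
  private
    module G = Graph G
    module H = Graph H
  field
    bijection : V ↔ W
  open Inverse bijection public using (to; from)
  field
    adjacency : ∀ u v → (u G.~ v) ⇔ (to u H.~ to v)

Connected : {V : Set} → Graph V → Set
Connected G = ∀ u v → Star (Graph._~_ G) u v

induced : {m : ℕ} → Graph (Fin m) → (S : Subset m) → Graph (∃ (_∈ S))
induced G S = record
  { _~_   = λ u v → proj₁ u ~ proj₁ v
  ; _~?_  = λ u v → proj₁ u ~? proj₁ v
  ; ~-sym = ~-sym
  ; ~-irr = ~-irr
  }
  where open Graph G

module _ (n : ℕ) where

  Next : Rel (Fin n) 0ℓ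
  Next i j = (toℕ j ≡ suc (toℕ i)) ⊎ (suc (toℕ i) ≡ n × toℕ j ≡ 0)

  next? : Decidable Next
  next? i j =
    (toℕ j ℕ.≟ suc (toℕ i)) ⊎-dec ((suc (toℕ i) ℕ.≟ n) ×-dec (toℕ j ℕ.≟ 0))

  next-irr : 3 ≤ n → ∀ {i} → ¬ Next i i
  next-irr n≥3 (inj₁ i≡1+i) = ℕ.1+n≢n (sym i≡1+i)
  next-irr n≥3 {i} (inj₂ (1+i≡n , i≡0)) =
    ℕ.<-irrefl (trans (sym (cong suc i≡0)) 1+i≡n) (ℕ.≤-trans (s≤s (s≤s z≤n)) n≥3)

cycle : (n : ℕ) → 3 ≤ n → Graph (Fin n)
cycle n n≥3 = record
  { _~_   = λ i j → Next n i j ⊎ Next n j i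
  ; _~?_  = λ i j → next? n i j ⊎-dec next? n j i
  ; ~-sym = swap
  ; ~-irr = λ { (inj₁ p) → next-irr n n≥3 p ; (inj₂ p) → next-irr n n≥3 p }
  }

K₁ : Graph ⊤
K₁ = record
  { _~_   = λ _ _ → ⊥
  ; _~?_  = λ _ _ → no λ ()
  ; ~-sym = λ ()
  ; ~-irr = λ ()
  }

module _ {V W : Set} (G : Graph V) (H : Graph W) where
  private
    module G = Graph G
    module H = Graph H

  JoinAdj : Rel (V ⊎ W) 0ℓ
  JoinAdj (inj₁ u) (inj₁ v) = u G.~ v
  JoinAdj (inj₁ _) (inj₂ _) = ⊤
  JoinAdj (inj₂ _) (inj₁ _) = ⊤
  JoinAdj (inj₂ u) (inj₂ v) = u H.~ v

  joinAdj? : Decidable JoinAdj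
  joinAdj? (inj₁ u) (inj₁ v) = u G.~? v
  joinAdj? (inj₁ _) (inj₂ _) = yes tt
  joinAdj? (inj₂ _) (inj₁ _) = yes tt
  joinAdj? (inj₂ u) (inj₂ v) = u H.~? v

  joinAdj-sym : Symmetric JoinAdj
  joinAdj-sym {inj₁ _} {inj₁ _} p = G.~-sym p
  joinAdj-sym {inj₁ _} {inj₂ _} p = tt
  joinAdj-sym {inj₂ _} {inj₁ _} p = tt
  joinAdj-sym {inj₂ _} {inj₂ _} p = H.~-sym p

  joinAdj-irr : ∀ {v} → ¬ JoinAdj v v
  joinAdj-irr {inj₁ _} p = G.~-irr p
  joinAdj-irr {inj₂ _} p = H.~-irr p

  join : Graph (V ⊎ W)
  join = record
    { _~_ = JoinAdj ; _~?_ = joinAdj? ; ~-sym = λ {u} {v} → joinAdj-sym {u} {v}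
    ; ~-irr = λ {v} → joinAdj-irr {v} }

wheel : (n : ℕ) → 3 ≤ n → Graph (Fin n ⊎ ⊤)
wheel n n≥3 = join (cycle n n≥3) K₁

-- Floyd–Warshall: `Via ws u v` says that v can be reached from u in at most
-- one step, or through intermediate vertices taken from ws.

module Reachability {V : Set} {R : Rel V 0ℓ} (R? : Decidable R)
                    (_≟_ : Decidable {A = V} _≡_)
                    (all : List V) (complete : ∀ v → v List.∈ all) where

  Via : List V → Rel V 0ℓ
  Via []       u v = (u ≡ v) ⊎ R u v
  Via (w ∷ ws) u v = Via ws u v ⊎ (Via ws u w × Via ws w v)

  via? : ∀ ws → Decidable (Via ws)
  via? []       u v = (u ≟ v) ⊎-dec R? u v
  via? (w ∷ ws) u v = via? ws u v ⊎-dec (via? ws u w ×-dec via? ws w v)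

  via⇒star : ∀ ws {u v} → Via ws u v → Star R u v
  via⇒star []       (inj₁ refl)    = ε
  via⇒star []       (inj₂ r)       = r ◅ ε
  via⇒star (w ∷ ws) (inj₁ p)       = via⇒star ws p
  via⇒star (w ∷ ws) (inj₂ (p , q)) = via⇒star ws p ◅◅ via⇒star ws q

  via-base : ∀ ws {u v} → Via [] u v → Via ws u v
  via-base []       p = p
  via-base (w ∷ ws) p = inj₁ (via-base ws p)

  via-trans : ∀ ws {u v w} → w List.∈ ws → Via ws u w → Via ws w v → Via ws u v
  via-trans (a ∷ ws) (Any.here refl) p q = inj₂ (left p , right q)
    where
    left : ∀ {u} → Via (a ∷ ws) u a → Via ws u a
    left (inj₁ p)       = p
    left (inj₂ (p , _)) = p
    right : ∀ {v} → Via (a ∷ ws) a v → Via ws a v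
    right (inj₁ q)       = q
    right (inj₂ (_ , q)) = q
  via-trans (a ∷ ws) (Any.there i) (inj₁ p)       (inj₁ q)        = inj₁ (via-trans ws i p q)
  via-trans (a ∷ ws) (Any.there i) (inj₁ p)       (inj₂ (q , q′)) = inj₂ (via-trans ws i p q , q′)
  via-trans (a ∷ ws) (Any.there i) (inj₂ (p , p′)) (inj₁ q)       = inj₂ (p , via-trans ws i p′ q)
  via-trans (a ∷ ws) (Any.there i) (inj₂ (p , _)) (inj₂ (_ , q′)) = inj₂ (p , q′)

  star⇒via : ∀ {u v} → Star R u v → Via all u v
  star⇒via ε                = via-base all (inj₁ refl)
  star⇒via (_◅_ {j = j} r s) = via-trans all (complete j) (via-base all (inj₂ r)) (star⇒via s)

  star? : Decidable (Star R)
  star? u v = map′ (via⇒star all) star⇒via (via? all u v)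

  all-star? : Dec (∀ u v → Star R u v)
  all-star? = map′
    (λ ps u v → All.lookup (All.lookup ps (complete u)) (complete v))
    (λ f → All.universal (λ u → All.universal (f u) all) all)
    (All.all? (λ u → All.all? (star? u) all) all)

elements : {m : ℕ} (S : Subset m) → List (∃ (_∈ S))
elements []            = []
elements (inside  ∷ S) = (zero , here) ∷ map (λ (v , p) → suc v , there p) (elements S)
elements (outside ∷ S) = map (λ (v , p) → suc v , there p) (elements S)

elements-complete : {m : ℕ} (S : Subset m) (v : ∃ (_∈ S)) → v List.∈ elements S
elements-complete (inside  ∷ S) (zero  , here)    = Any.here refl
elements-complete (inside  ∷ S) (suc v , there p) = Any.there (∈-map⁺ _ (elements-complete S (v , p)))
elements-complete (outside ∷ S) (suc v , there p) = ∈-map⁺ _ (elements-complete S (v , p))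

∃∈-≟ : {m : ℕ} {S : Subset m} → Decidable {A = ∃ (_∈ S)} _≡_
∃∈-≟ {S = _ ∷ S} (zero  , here)    (zero  , here)    = yes refl
∃∈-≟ {S = _ ∷ S} (zero  , here)    (suc v , there q) = no λ ()
∃∈-≟ {S = _ ∷ S} (suc u , there p) (zero  , here)    = no λ ()
∃∈-≟ {S = _ ∷ S} (suc u , there p) (suc v , there q) =
  map′ (λ { refl → refl }) (λ { refl → refl }) (∃∈-≟ {S = S} (u , p) (v , q))

connected? : {m : ℕ} (G : Graph (Fin m)) (S : Subset m) → Dec (Connected (induced G S))
connected? G S =
  Reachability.all-star? (Graph._~?_ (induced G S)) ∃∈-≟ (elements S) (elements-complete S)

-- Polynomials as coefficient lists, constant coefficient first.
module Polynomial (A : Set) (_∙_ : A → A → A) (0# : A) where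

  Poly : Set
  Poly = List A

  coeff : ℕ → Poly → A
  coeff k       []      = 0#
  coeff zero    (a ∷ p) = a
  coeff (suc k) (a ∷ p) = coeff k p

  infixl 6 _⊕_
  _⊕_ : Poly → Poly → Poly
  []      ⊕ q       = q
  p       ⊕ []      = p
  (a ∷ p) ⊕ (b ∷ q) = (a ∙ b) ∷ (p ⊕ q)

  monomial : A → ℕ → Poly
  monomial a k = replicate k 0# ++ [ a ]

  sum : List Poly → Poly
  sum = foldr _⊕_ []

module Y  = Polynomial ℕ _+_ 0
module XY = Polynomial Y.Poly Y._⊕_ []

ℕ[y] : Set
ℕ[y] = Y.Poly

ℕ[y][x] : Set
ℕ[y][x] = XY.Poly

infixl 6 _⊕_
_⊕_ : ℕ[y] → ℕ[y] → ℕ[y]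
_⊕_ = Y._⊕_

infix 7 _·y^_
_·y^_ : ℕ → ℕ → ℕ[y]
c ·y^ k = Y.monomial c k

-- Coefficient lists may have trailing zeros, so `_≡_` would be too fine.
infix 4 _≈_
_≈_ : ℕ[y] → ℕ[y] → Set
p ≈ q = ∀ k → Y.coeff k p ≡ Y.coeff k q

infix 5 [x^_]_
[x^_]_ : ℕ → ℕ[y][x] → ℕ[y]
[x^ k ] p = XY.coeff k p

subsets : (m : ℕ) → List (Subset m)
subsets zero    = [ [] ]
subsets (suc m) = map (inside ∷_) (subsets m) ++ map (outside ∷_) (subsets m)

-- The value at [] is never used: da ranges over non-empty subsets.
minimum : List ℕ → ℕ
minimum []       = 0
minimum (k ∷ ks) = min k ks

module _ {m : ℕ} (G : Graph (Fin m)) where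
  open Graph G

  neighbours : Fin m → Subset m
  neighbours u = tabulate (λ v → does (u ~? v))

  δ : Subset m → Fin m → ℕ
  δ S u = ∣ S ∩ neighbours u ∣

  -- δ_S(u) − δ_S̄(u) + |V(G)|; the subtraction is never truncated, as
  -- `balance-exact` shows.
  balance : Subset m → Fin m → ℕ
  balance S u = (δ S u + m) ∸ δ (∁ S) u

  balance-exact : ∀ S u → + balance S u ≡ + δ S u ℤ.- + δ (∁ S) u ℤ.+ + m
  balance-exact S u = begin
    + (a + m ∸ b)              ≡⟨ ℤ.⊖-≥ b≤a+m ⟨
    (a + m) ℤ.⊖ b              ≡⟨ ℤ.m-n≡m⊖n (a + m) b ⟨
    + a ℤ.+ + m ℤ.- + b        ≡⟨ ℤ.+-assoc (+ a) (+ m) (ℤ.- + b) ⟩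
    + a ℤ.+ (+ m ℤ.- + b)      ≡⟨ cong (λ z → + a ℤ.+ z) (ℤ.+-comm (+ m) (ℤ.- + b)) ⟩
    + a ℤ.+ (ℤ.- + b ℤ.+ + m)  ≡⟨ ℤ.+-assoc (+ a) (ℤ.- + b) (+ m) ⟨
    + a ℤ.- + b ℤ.+ + m        ∎
    where
    open ≡-Reasoning
    a = δ S u
    b = δ (∁ S) u
    b≤a+m : b ≤ a + m
    b≤a+m = ℕ.≤-trans (∣p∣≤n (∁ S ∩ neighbours u)) (ℕ.m≤n+m m a)

  f-y : Subset m → ℕ
  f-y S = minimum (map (λ (u , _) → balance S u) (elements S))

  connectedSubsets : List (Subset m)
  connectedSubsets = filter (λ S → nonempty? S ×-dec connected? G S) (subsets m)

  da : ℕ[y][x]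
  da = XY.sum (map (λ S → XY.monomial (1 ·y^ f-y S) ∣ S ∣) connectedSubsets)

module Submission where

-- The coefficient of x records the numbers m − deg v, so it says that there are
-- n + 1 vertices, that some h is adjacent to all others and that these have
-- degree 3. The sets of size n are the complements of single vertices, and since
-- the coefficient of xⁿ counts n + 1 of them, G − h is connected. A connected
-- 2-regular graph is a cycle: a walk that never backtracks first meets itself at
-- its starting point, and the closed walk obtained exhausts the graph.
-- Conversely, in the wheel all degrees are at least 3 and every vertex has a rim
-- vertex, of degree 3, as a neighbour; this determines the two minima f_y.

open import Defs
open import Data.Bool.Base using (if_then_else_)
open import Data.Bool.Properties using (not-involutive)
open import Data.Fin.Base using (Fin; zero; suc; toℕ; fromℕ<; punchIn; punchOut)
open import Data.Fin.Induction using (<-weakInduction)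
import Data.Fin.Permutation as Permutation
open import Data.Fin.Properties
  using ( _≟_; any?; injective⇒≤; pigeonhole; punchInᵢ≢i; punchIn-injective; punchIn-punchOut
        ; toℕ<n; toℕ-fromℕ<; toℕ-injective; toℕ-inject₁; 1↔⊤; +↔⊎ )
open import Data.Fin.Subset using (Subset; inside; outside; _∈_; _∩_; ∁; ∣_∣; ⊥; ⁅_⁆; Nonempty)
open import Data.Fin.Subset.Properties
  using ( _∈?_; nonempty?; x∈p∩q⁺; x∈p∩q⁻; x∈p⇒x∉∁p; x∉p⇒x∈∁p; x∈∁p⇒x∉p; x∈⁅y⁆⇒x≡y; x∈⁅x⁆
        ; ∣∁p∣≡n∸∣p∣; ∣⁅x⁆∣≡1; ∣⊥∣≡0; ∣p∣≤n; ∉⊥ )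
open import Data.List.Base using (List; []; _∷_; _++_; map; filter)
open import Data.List.Extrema.Nat using (v≤min⁺; min≤v⁺)
import Data.List.Membership.Propositional as List
open import Data.List.Membership.Propositional.Properties using (∈-map⁺)
import Data.List.Properties as List
import Data.List.Relation.Unary.All as All
import Data.List.Relation.Unary.All.Properties as All
open import Data.List.Relation.Unary.Any as Any using (here; there)
open import Data.Nat.Base using (ℕ; zero; suc; _+_; _∸_; _*_; _≤_; _<_; z≤n; s≤s; NonZero)
open import Data.Nat.ListAction using () renaming (sum to sumᴸ)
open import Data.Nat.ListAction.Properties using (sum-++)
import Data.Nat.Properties as ℕ
open import Data.Product.Base using (∃; ∃₂; _×_; _,_; proj₁; proj₂; map₂)
open import Data.Sum.Base using (_⊎_; inj₁; inj₂; [_,_]′)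
open import Data.Sum.Function.Propositional using (_⊎-↔_)
open import Data.Unit.Base using (⊤; tt)
open import Data.Vec.Base as Vec using ([]; _∷_)
import Data.Vec.Properties as Vec
open import Data.Vec.Properties.WithK using ([]=-irrelevant)
open import Function.Base using (_∘_; _$_)
open import Function.Bundles using (_⇔_; Inverse; Equivalence; mk⇔; mk↔ₛ′)
open import Function.Construct.Identity using (↔-id)
open import Function.Properties.Equivalence using () renaming (sym to ⇔-sym)
open import Function.Properties.Inverse using (↔-sym; ↔-trans)
open import Relation.Binary.Construct.Closure.ReflexiveTransitive
  using (Star; ε; _◅_; _◅◅_; gmap; reverse)
open import Relation.Binary.PropositionalEquality
open import Relation.Nullary.Decidable
  using (Dec; yes; no; does; dec-true; dec-false; does-⇔; _⊎-dec_; _×-dec_)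
open import Relation.Nullary.Negation using (¬_; contradiction)
open import Relation.Unary using (Decidable)

open import Algebra.Properties.CommutativeMonoid.Sum ℕ.+-0-commutativeMonoid
  using (sum; sum-cong-≗; sum-remove; sum-permute; ∑-distrib-+)

private variable
  P Q : Set
  m n : ℕ

-- Counting in Fin n

-- The Iverson bracket. It depends only on `does`, so brackets of `×-dec` and `⊎-dec` compute as
-- soon as the first decision is known.
⟦_⟧ : Dec P → ℕ
⟦ p? ⟧ = if does p? then 1 else 0

⟦⟧-true : (p? : Dec P) → P → ⟦ p? ⟧ ≡ 1
⟦⟧-true p? p = cong (if_then 1 else 0) (dec-true p? p)

⟦⟧-false : (p? : Dec P) → ¬ P → ⟦ p? ⟧ ≡ 0
⟦⟧-false p? ¬p = cong (if_then 1 else 0) (dec-false p? ¬p)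

⟦⟧-cong : P ⇔ Q → (p? : Dec P) (q? : Dec Q) → ⟦ p? ⟧ ≡ ⟦ q? ⟧
⟦⟧-cong P⇔Q p? q? = cong (if_then 1 else 0) (does-⇔ P⇔Q p? q?)

⟦⟧-proof : (p? : Dec P) → ⟦ p? ⟧ ≢ 0 → P
⟦⟧-proof (yes p) _ = p
⟦⟧-proof (no _)  0≢0 = contradiction refl 0≢0

⟦⟧≤1 : (p? : Dec P) → ⟦ p? ⟧ ≤ 1
⟦⟧≤1 (yes _) = ℕ.≤-refl
⟦⟧≤1 (no _)  = z≤n

⟦⟧-⊎ : (p? : Dec P) (q? : Dec Q) → ¬ (P × Q) → ⟦ p? ⊎-dec q? ⟧ ≡ ⟦ p? ⟧ + ⟦ q? ⟧
⟦⟧-⊎ (yes p) (yes q) ¬pq = contradiction (p , q) ¬pq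
⟦⟧-⊎ (yes _) (no _)  _   = refl
⟦⟧-⊎ (no _)  (yes _) _   = refl
⟦⟧-⊎ (no _)  (no _)  _   = refl

sum-const : {t : Fin n → ℕ} {c : ℕ} → (∀ i → t i ≡ c) → sum t ≡ n * c
sum-const {zero}  t≡c = refl
sum-const {suc n} t≡c = cong₂ _+_ (t≡c zero) (sum-const (t≡c ∘ suc))

sum-zero : {t : Fin n → ℕ} → (∀ i → t i ≡ 0) → sum t ≡ 0
sum-zero {n} t≡0 = trans (sum-const t≡0) (ℕ.*-zeroʳ n)

sum≡0⇒ : {t : Fin n → ℕ} → sum t ≡ 0 → ∀ i → t i ≡ 0
sum≡0⇒ {suc n} {t} Σ≡0 i = ℕ.m+n≡0⇒m≡0 (t i) (trans (sym (sum-remove {i = i} t)) Σ≡0)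

sum≢0⇒ : {t : Fin n → ℕ} → sum t ≢ 0 → ∃ λ i → t i ≢ 0
sum≢0⇒ {zero}  Σ≢0 = contradiction refl Σ≢0
sum≢0⇒ {suc n} {t} Σ≢0 with t zero in eq
... | suc _ = zero , λ t₀≡0 → ℕ.1+n≢0 (trans (sym eq) t₀≡0)
... | zero  with sum≢0⇒ {t = t ∘ suc} Σ≢0
...   | i , tᵢ≢0 = suc i , tᵢ≢0

sum-bounded : {t : Fin n → ℕ} → (∀ i → t i ≤ 1) → sum t ≤ n
sum-bounded {zero}  t≤1 = z≤n
sum-bounded {suc n} t≤1 = ℕ.+-mono-≤ (t≤1 zero) (sum-bounded (t≤1 ∘ suc))

-- The other terms are bounded by their number, one less than the total, so at least 1 is left for
-- `t i`.
sum-saturated : {t : Fin n → ℕ} → (∀ i → t i ≤ 1) → sum t ≡ n → ∀ i → t i ≡ 1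
sum-saturated {suc n} {t} t≤1 Σ≡n i = ℕ.≤-antisym (t≤1 i)
  (ℕ.+-cancelʳ-≤ n 1 (t i) (subst (_≤ t i + n) (trans (sym (sum-remove {i = i} t)) Σ≡n)
    (ℕ.+-monoʳ-≤ (t i) (sum-bounded (t≤1 ∘ punchIn i)))))

punchIn-surjective : (i : Fin (suc n)) {j : Fin (suc n)} → j ≢ i → ∃ λ k → punchIn i k ≡ j
punchIn-surjective i j≢i = punchOut (j≢i ∘ sym) , punchIn-punchOut (j≢i ∘ sym)

sum-single : {t : Fin n → ℕ} (i : Fin n) → (∀ j → j ≢ i → t j ≡ 0) → sum t ≡ t i
sum-single {suc n} {t} i t≡0 = trans (sum-remove {i = i} t)
  (trans (cong (t i +_) (sum-zero λ j → t≡0 (punchIn i j) (punchInᵢ≢i i j))) (ℕ.+-identityʳ (t i)))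

module _ {P : Fin n → Set} (P? : Decidable P) where

  count : ℕ
  count = sum (λ i → ⟦ P? i ⟧)

  count≢0⇒ : count ≢ 0 → ∃ P
  count≢0⇒ c≢0 with i , p≢0 ← sum≢0⇒ c≢0 = i , ⟦⟧-proof (P? i) p≢0

  count≡0⇒ : count ≡ 0 → ∀ i → ¬ P i
  count≡0⇒ c≡0 i p = ℕ.1+n≢0 (trans (sym (⟦⟧-true (P? i) p)) (sum≡0⇒ c≡0 i))

  count-all : (∀ i → P i) → count ≡ n
  count-all p = trans (sum-const (λ i → ⟦⟧-true (P? i) (p i))) (ℕ.*-identityʳ n)

  count-none : (∀ i → ¬ P i) → count ≡ 0
  count-none ¬p = sum-zero (λ i → ⟦⟧-false (P? i) (¬p i))

  count-full⇒ : count ≡ n → ∀ i → P i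
  count-full⇒ c≡n i = ⟦⟧-proof (P? i) λ p≡0 →
    ℕ.1+n≢0 (trans (sym (sum-saturated (λ j → ⟦⟧≤1 (P? j)) c≡n i)) p≡0)

  count-unique : (i : Fin n) → P i → (∀ j → P j → j ≡ i) → count ≡ 1
  count-unique i p unique =
    trans (sum-single i λ j j≢i → ⟦⟧-false (P? j) (j≢i ∘ unique j)) (⟦⟧-true (P? i) p)

count-cong : {P Q : Fin n → Set} (P? : Decidable P) (Q? : Decidable Q) →
             (∀ i → P i ⇔ Q i) → count P? ≡ count Q?
count-cong P? Q? P⇔Q = sum-cong-≗ λ i → ⟦⟧-cong (P⇔Q i) (P? i) (Q? i)

count-punchIn : {P : Fin (suc n) → Set} (P? : Decidable P) {k : ℕ} (i : Fin (suc n)) → P i →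
               count P? ≡ suc k → count (P? ∘ punchIn i) ≡ k
count-punchIn P? i p c≡ = ℕ.suc-injective (trans (sym (trans (sum-remove {i = i} (λ j → ⟦ P? j ⟧))
  (cong (_+ count (P? ∘ punchIn i)) (⟦⟧-true (P? i) p)))) c≡)

count≡1⇒ : {P : Fin n → Set} (P? : Decidable P) → count P? ≡ 1 →
           ∃ λ i → P i × ∀ j → P j → j ≡ i
count≡1⇒ {zero} P? ()
count≡1⇒ {suc n} {P} P? c≡1 with i , p ← count≢0⇒ P? (λ c≡0 → ℕ.1+n≢0 (trans (sym c≡1) c≡0))
  = i , p , unique
  where
  unique : ∀ j → P j → j ≡ i
  unique j q with j ≟ i
  ... | yes j≡i = j≡i
  ... | no  j≢i with k , refl ← punchIn-surjective i j≢i =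
    contradiction q (count≡0⇒ (P? ∘ punchIn i) (count-punchIn P? i p c≡1) k)

-- At a vertex of degree 2 this turns the neighbour by which a walk arrives into the one by which it
-- leaves.
count≡2⇒ : {P : Fin n → Set} (P? : Decidable P) → count P? ≡ 2 → (i : Fin n) → P i →
           ∃ λ j → j ≢ i × P j × ∀ k → P k → k ≡ i ⊎ k ≡ j
count≡2⇒ {suc n} {P} P? c≡2 i p
  with j , q , unique ← count≡1⇒ (P? ∘ punchIn i) (count-punchIn P? i p c≡2)
  = punchIn i j , punchInᵢ≢i i j , q , cover
  where
  cover : ∀ k → P k → k ≡ i ⊎ k ≡ punchIn i j
  cover k r with k ≟ i
  ... | yes k≡i = inj₁ k≡i
  ... | no  k≢i with l , refl ← punchIn-surjective i k≢i = inj₂ (cong (punchIn i) (unique l r))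

-- Connected 2-regular graphs

deg : {m : ℕ} → Graph (Fin m) → Fin m → ℕ
deg G u = count (Graph._~?_ G u)

module _ {n : ℕ} (n≥3 : 3 ≤ n) (H : Graph (Fin n))
         (2-regular : ∀ u → deg H u ≡ 2) (connected : Connected H) where
  open Graph H

  private
    -- A directed edge is the state of the walk: it determines all that follows, since the vertex
    -- ahead has only one other neighbour.
    Dart : Set
    Dart = ∃₂ λ u v → u ~ v

    other : ∀ u v → v ~ u → ∃ λ w → w ≢ u × v ~ w × ∀ x → v ~ x → x ≡ u ⊎ x ≡ w
    other u v v~u = count≡2⇒ (v ~?_) (2-regular v) u v~u

    advance : Dart → Dart
    advance (u , v , u~v) = let w , _ , v~w , _ = other u v (~-sym u~v) in v , w , v~w

    dart : ℕ → Dart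
    -- The walk starts at vertex 0 along any edge; there is one because the degree 2 is not 0.
    dart zero    = let o = fromℕ< (ℕ.≤-trans (s≤s z≤n) n≥3)
                       v , o~v = count≢0⇒ (o ~?_) (λ d≡0 → ℕ.0≢1+n (trans (sym d≡0) (2-regular o)))
                   in o , v , o~v
    dart (suc k) = advance (dart k)

    p : ℕ → Fin n
    p k = proj₁ (dart k)

    edge : ∀ k → p k ~ p (suc k)
    edge k = proj₂ (proj₂ (dart k))

    no-backtrack : ∀ k → p (suc (suc k)) ≢ p k
    no-backtrack k = proj₁ (proj₂ (other _ _ (~-sym (edge k))))

    neighbours-suc : ∀ k {x} → p (suc k) ~ x → x ≡ p k ⊎ x ≡ p (suc (suc k))
    neighbours-suc k = proj₂ (proj₂ (proj₂ (other _ _ (~-sym (edge k))))) _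

    p≢p-suc : ∀ k → p k ≢ p (suc k)
    p≢p-suc k eq = ~-irr (subst (p k ~_) (sym eq) (edge k))

    Injective< : ℕ → Set
    Injective< r = ∀ {i j} → i < r → j < r → p i ≡ p j → i ≡ j

    injective<-suc : ∀ {r} → Injective< r → (∀ {i} → i < r → p i ≢ p r) → Injective< (suc r)
    injective<-suc {r} inj new {i} {j} i<1+r j<1+r eq
      with ℕ.m≤n⇒m<n∨m≡n (ℕ.≤-pred i<1+r) | ℕ.m≤n⇒m<n∨m≡n (ℕ.≤-pred j<1+r)
    ... | inj₁ i<r  | inj₁ j<r  = inj i<r j<r eq
    ... | inj₁ i<r  | inj₂ refl = contradiction eq (new i<r)
    ... | inj₂ refl | inj₁ j<r  = contradiction (sym eq) (new j<r)
    ... | inj₂ refl | inj₂ refl = refl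

    -- The search extends the injective stretch by one index at a time and stops at the first `r`
    -- whose vertex occurred before. By the pigeonhole principle it cannot pass through `suc n`
    -- indices, as there are only `n` vertices.
    first-repetition : ∃₂ λ r i → Injective< r × i < r × p i ≡ p r
    first-repetition with search (suc n)
      where
      search : ∀ s → Injective< s ⊎ ∃₂ λ r i → Injective< r × i < r × p i ≡ p r
      search zero    = inj₁ λ ()
      search (suc s) with search s
      ... | inj₂ found = inj₂ found
      ... | inj₁ inj with any? (λ (i : Fin s) → p (toℕ i) ≟ p s)
      ...   | yes (i , eq) = inj₂ (s , toℕ i , inj , toℕ<n i , eq)
      ...   | no fresh     = inj₁ (injective<-suc inj λ i<s eq →
                fresh (fromℕ< i<s , trans (cong p (toℕ-fromℕ< i<s)) eq))
    ... | inj₂ found = found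
    ... | inj₁ inj   =
      let i , j , i<j , eq = pigeonhole ℕ.≤-refl (p ∘ toℕ)
      in contradiction (inj (toℕ<n i) (toℕ<n j) eq) (ℕ.<⇒≢ i<j)

    -- A return to p (suc i) would arrive from p i or p (2 + i), both already visited.
    return-to-start : ∀ {r i} → Injective< r → i < r → p i ≡ p r → i ≡ 0
    return-to-start {i = zero}  _ _ _ = refl
    return-to-start {suc r} {suc i} inj 1+i<1+r eq
      with neighbours-suc i (subst (_~ p r) (sym eq) (~-sym (edge r)))
    ... | inj₁ pr≡pi = contradiction (inj ℕ.≤-refl (ℕ.<⇒≤ 1+i<1+r) pr≡pi) (ℕ.>⇒≢ (ℕ.≤-pred 1+i<1+r))
    ... | inj₂ pr≡p2+i with ℕ.m≤n⇒m<n∨m≡n 1+i<1+r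
    ...   | inj₂ refl = contradiction eq (p≢p-suc (suc i))
    ...   | inj₁ 2+i<1+r with refl ← inj ℕ.≤-refl 2+i<1+r pr≡p2+i =
            contradiction (sym eq) (no-backtrack (suc i))

  -- The first `r` vertices form a closed walk without repetitions. The length `r` stays a variable
  -- until `length≡n` identifies it with `n`.
  module Cycle (r : ℕ) (inj : Injective< r) (0<r : 0 < r) (closed : p 0 ≡ p r) where
    private
      -- This is `Next r` read on natural numbers, so that for `r` equal to `n` no translation to
      -- the adjacency of `cycle` is needed.
      Step : ℕ → ℕ → Set
      Step k l = l ≡ suc k ⊎ (suc k ≡ r × l ≡ 0)

    step⇒edge : ∀ {k l} → Step k l → p k ~ p l
    step⇒edge {k} (inj₁ refl)          = edge k
    step⇒edge {k} (inj₂ (refl , refl)) = subst (p k ~_) (sym closed) (edge k)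

    successor : ∀ {k} → k < r → ∃ λ l → l < r × p l ≡ p (suc k) × Step k l
    successor {k} k<r with ℕ.m≤n⇒m<n∨m≡n k<r
    ... | inj₁ 1+k<r = suc k , 1+k<r , refl , inj₁ refl
    ... | inj₂ refl  = 0 , 0<r , closed , inj₂ (refl , refl)

    -- A closed walk of length 1 would contain a loop, one of length 2 would backtrack, and from
    -- length 3 on the indices 1 and `s` are distinct and below `r`.
    last-is-not-second : ∀ s → suc s ≡ r → p 1 ≢ p s
    last-is-not-second zero          refl eq = p≢p-suc 0 (sym eq)
    last-is-not-second (suc zero)    refl eq = no-backtrack 0 (sym closed)
    last-is-not-second (suc (suc s)) refl eq with () ← inj (s≤s (s≤s z≤n)) ℕ.≤-refl eq

    -- Nothing precedes index 0, but `p 0` is also `p r`. With `r` the successor of `s`, its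
    -- neighbours are therefore `p s` and `p (2 + s)`; as `p 1` is a neighbour different from `p s`,
    -- it is `p (2 + s)`.
    neighbours-zero : ∀ {x} → p 0 ~ x → x ≡ p 1 ⊎ ∃ λ l → suc l ≡ r × x ≡ p l
    neighbours-zero {x} p0~x with s , refl ← ℕ.m≤n⇒∃[o]m+o≡n 0<r
      with neighbours-suc s (subst (_~ x) closed p0~x) | neighbours-suc s (subst (_~ p 1) closed (edge 0))
    ... | inj₁ x≡ps   | _              = inj₂ (s , refl , x≡ps)
    ... | inj₂ x≡p2+s | inj₂ p1≡p2+s   = inj₁ (trans x≡p2+s (sym p1≡p2+s))
    ... | inj₂ _      | inj₁ p1≡ps     = contradiction p1≡ps (last-is-not-second s refl)

    -- This serves twice: the visited vertices are closed under adjacency, hence exhaust `H`, and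
    -- every edge of `H` is a step of the cycle.
    neighbours-of : ∀ k → k < r → ∀ {x} → p k ~ x → ∃ λ l → l < r × p l ≡ x × (Step k l ⊎ Step l k)
    neighbours-of zero 0<r p0~x with neighbours-zero p0~x
    ... | inj₁ refl              = map₂ (map₂ (map₂ inj₁)) (successor 0<r)
    ... | inj₂ (l , refl , refl) = l , ℕ.≤-refl , refl , inj₂ (inj₂ (refl , refl))
    neighbours-of (suc k) 1+k<r p1+k~x with neighbours-suc k p1+k~x
    ... | inj₁ refl = k , ℕ.<⇒≤ 1+k<r , refl , inj₂ (inj₁ refl)
    ... | inj₂ refl = map₂ (map₂ (map₂ inj₁)) (successor 1+k<r)

    -- Connectedness gives a path from `p 0` to `v`, and `neighbours-of` keeps each of its vertices
    -- on the cycle.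
    visited : ∀ v → ∃ λ (i : Fin r) → p (toℕ i) ≡ v
    visited v = follow (connected (p 0) v) (fromℕ< 0<r , cong p (toℕ-fromℕ< 0<r))
      where
      follow : ∀ {u} → Star _~_ u v → (∃ λ (i : Fin r) → p (toℕ i) ≡ u) → ∃ λ (i : Fin r) → p (toℕ i) ≡ v
      follow ε          found      = found
      follow (e ◅ path) (i , refl) with l , l<r , refl , _ ← neighbours-of (toℕ i) (toℕ<n i) e =
        follow path (fromℕ< l<r , cong p (toℕ-fromℕ< l<r))

    -- There are injections both ways: `p` on the indices by `inj`, and `visited` on the vertices
    -- because `p` recovers the vertex from its index.
    length≡n : r ≡ n
    length≡n = ℕ.≤-antisym
      (injective⇒≤ {f = p ∘ toℕ} λ eq → toℕ-injective (inj (toℕ<n _) (toℕ<n _) eq))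
      (injective⇒≤ {f = proj₁ ∘ visited} λ {u} {v} eq →
        trans (sym (proj₂ (visited u))) (trans (cong (p ∘ toℕ) eq) (proj₂ (visited v))))

  2-regular⇒cycle : H ≅ cycle n n≥3
  2-regular⇒cycle with r , i , inj , i<r , eq ← first-repetition
    with refl ← return-to-start inj i<r eq
    with refl ← Cycle.length≡n r inj i<r eq = record
      { bijection = mk↔ₛ′ (proj₁ ∘ visited) (p ∘ toℕ) (λ i → p-injective (proj₂ (visited _))) (proj₂ ∘ visited)
      ; adjacency = λ u v → mk⇔ (to u v) (from u v)
      }
      where
      open Cycle r inj i<r eq
      p-injective : ∀ {i j : Fin n} → p (toℕ i) ≡ p (toℕ j) → i ≡ j
      p-injective eq = toℕ-injective (inj (toℕ<n _) (toℕ<n _) eq)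

      Adjacent : Fin n → Fin n → Set
      Adjacent = Graph._~_ (cycle n n≥3)

      to : ∀ u v → u ~ v → Adjacent (proj₁ (visited u)) (proj₁ (visited v))
      to u v u~v with visited u | visited v
      ... | i , refl | j , refl with l , l<n , eq′ , adj ← neighbours-of (toℕ i) (toℕ<n i) u~v
        with refl ← inj l<n (toℕ<n j) eq′ = adj

      from : ∀ u v → Adjacent (proj₁ (visited u)) (proj₁ (visited v)) → u ~ v
      from u v adj with visited u | visited v
      ... | i , refl | j , refl = [ step⇒edge , ~-sym ∘ step⇒edge ]′ adj

-- Coefficients of da

-- Applied at both levels: with coefficients in `ℕ` for `Yₚ` and in `ℕ[y]` for `XYₚ`. The identity
-- laws account for summands of unequal length.
module CoefficientProperties (A : Set) (_∙_ : A → A → A) (0# : A)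
  (identityˡ : ∀ a → 0# ∙ a ≡ a) (identityʳ : ∀ a → a ∙ 0# ≡ a) where
  open Polynomial A _∙_ 0# renaming (_⊕_ to _⊞_)

  coeff-⊕ : ∀ k p q → coeff k (p ⊞ q) ≡ coeff k p ∙ coeff k q
  coeff-⊕ k       []      q       = sym (identityˡ (coeff k q))
  coeff-⊕ k       (a ∷ p) []      = sym (identityʳ (coeff k (a ∷ p)))
  coeff-⊕ zero    (a ∷ p) (b ∷ q) = refl
  coeff-⊕ (suc k) (a ∷ p) (b ∷ q) = coeff-⊕ k p q

  coeff-monomial : ∀ k a i → coeff k (monomial a i) ≡ (if does (i ℕ.≟ k) then a else 0#)
  coeff-monomial zero    a zero    = refl
  coeff-monomial (suc k) a zero    = refl
  coeff-monomial zero    a (suc i) = refl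
  coeff-monomial (suc k) a (suc i) = coeff-monomial k a i

Y-⊕-identityʳ : ∀ p → p Y.⊕ [] ≡ p
Y-⊕-identityʳ []      = refl
Y-⊕-identityʳ (_ ∷ _) = refl

module Yₚ  = CoefficientProperties ℕ _+_ 0 ℕ.+-identityˡ ℕ.+-identityʳ
module XYₚ = CoefficientProperties ℕ[y] Y._⊕_ [] (λ _ → refl) Y-⊕-identityʳ

coeff-·y^ : ∀ j c i → Y.coeff j (c ·y^ i) ≡ c * ⟦ i ℕ.≟ j ⟧
coeff-·y^ j c i = trans (Yₚ.coeff-monomial j c i) (lemma (i ℕ.≟ j))
  where
  lemma : (d : Dec (i ≡ j)) → (if does d then c else 0) ≡ c * ⟦ d ⟧
  lemma (yes _) = sym (ℕ.*-identityʳ c)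
  lemma (no _)  = sym (ℕ.*-zeroʳ c)

coeff-binomial : ∀ n c b j → Y.coeff j (n ·y^ c ⊕ 1 ·y^ b) ≡ n * ⟦ c ℕ.≟ j ⟧ + ⟦ b ℕ.≟ j ⟧
coeff-binomial n c b j = trans (Yₚ.coeff-⊕ j (n ·y^ c) (1 ·y^ b))
  (cong₂ _+_ (coeff-·y^ j n c) (trans (coeff-·y^ j 1 b) (ℕ.*-identityˡ _)))

coeff-x^·y^ : ∀ j k i l → Y.coeff j ([x^ k ] XY.monomial (1 ·y^ i) l) ≡ ⟦ (l ℕ.≟ k) ×-dec (i ℕ.≟ j) ⟧
coeff-x^·y^ j k i l = trans (cong (Y.coeff j) (XYₚ.coeff-monomial k (1 ·y^ i) l)) (lemma (l ℕ.≟ k))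
  where
  lemma : (d : Dec (l ≡ k)) → Y.coeff j (if does d then 1 ·y^ i else []) ≡ ⟦ d ×-dec (i ℕ.≟ j) ⟧
  lemma (yes _) = Yₚ.coeff-monomial j 1 i
  lemma (no _)  = refl

coeff-sum : ∀ {A : Set} j k (f : A → ℕ[y][x]) (xs : List A) →
            Y.coeff j ([x^ k ] XY.sum (map f xs)) ≡ sumᴸ (map (λ x → Y.coeff j ([x^ k ] f x)) xs)
coeff-sum j k f []       = refl
coeff-sum j k f (x ∷ xs) =
  trans (cong (Y.coeff j) (XYₚ.coeff-⊕ k (f x) (XY.sum (map f xs))))
  (trans (Yₚ.coeff-⊕ j ([x^ k ] f x) _) (cong (Y.coeff j ([x^ k ] f x) +_) (coeff-sum j k f xs)))

-- Moves the condition that defines `connectedSubsets` into the bracket, so that the sum runs over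
-- all subsets.
sum-filter : ∀ {A : Set} {P : A → Set} (P? : Decidable P) {Q : A → Set} (Q? : Decidable Q) xs →
             sumᴸ (map (λ x → ⟦ Q? x ⟧) (filter P? xs)) ≡ sumᴸ (map (λ x → ⟦ P? x ×-dec Q? x ⟧) xs)
sum-filter P? Q? []       = refl
sum-filter P? Q? (x ∷ xs) with P? x
... | yes _ = cong (⟦ Q? x ⟧ +_) (sum-filter P? Q? xs)
... | no _  = sum-filter P? Q? xs

-- Sums over all subsets

∑ₛ : (Subset m → ℕ) → ℕ
∑ₛ {m} g = sumᴸ (map g (subsets m))

∑ₛ-suc : (g : Subset (suc m) → ℕ) → ∑ₛ g ≡ ∑ₛ (g ∘ (inside ∷_)) + ∑ₛ (g ∘ (outside ∷_))
∑ₛ-suc {m} g = begin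
  sumᴸ (map g (ins ++ outs))           ≡⟨ cong sumᴸ (List.map-++ g ins outs) ⟩
  sumᴸ (map g ins ++ map g outs)       ≡⟨ sum-++ (map g ins) (map g outs) ⟩
  sumᴸ (map g ins) + sumᴸ (map g outs) ≡⟨ cong₂ _+_ (fuse inside) (fuse outside) ⟨
  ∑ₛ (g ∘ (inside ∷_)) + ∑ₛ (g ∘ (outside ∷_)) ∎
  where
  open ≡-Reasoning
  ins  = map (inside ∷_) (subsets m)
  outs = map (outside ∷_) (subsets m)
  fuse : ∀ s → ∑ₛ (g ∘ (s ∷_)) ≡ sumᴸ (map g (map (s ∷_) (subsets m)))
  fuse s = cong sumᴸ (List.map-∘ (subsets m))

∑ₛ-zero : (g : Subset m → ℕ) → (∀ S → g S ≡ 0) → ∑ₛ g ≡ 0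
∑ₛ-zero {zero}  g g≡0 = trans (ℕ.+-identityʳ _) (g≡0 [])
∑ₛ-zero {suc m} g g≡0 = trans (∑ₛ-suc g)
  (cong₂ _+_ (∑ₛ-zero _ (g≡0 ∘ (inside ∷_))) (∑ₛ-zero _ (g≡0 ∘ (outside ∷_))))

-- Complementation exchanges the subsets that begin with `inside` and those that begin with
-- `outside`. It reduces sizes `m` and `m ∸ 1` to sizes 0 and 1.
∑ₛ-∁ : (g : Subset m → ℕ) → ∑ₛ g ≡ ∑ₛ (g ∘ ∁)
∑ₛ-∁ {zero}  g = refl
∑ₛ-∁ {suc m} g = begin
  ∑ₛ g                                                 ≡⟨ ∑ₛ-suc g ⟩
  ∑ₛ (g ∘ (inside ∷_)) + ∑ₛ (g ∘ (outside ∷_))         ≡⟨ cong₂ _+_ (∑ₛ-∁ (g ∘ (inside ∷_))) (∑ₛ-∁ (g ∘ (outside ∷_))) ⟩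
  ∑ₛ (g ∘ (inside ∷_) ∘ ∁) + ∑ₛ (g ∘ (outside ∷_) ∘ ∁) ≡⟨ ℕ.+-comm (∑ₛ (g ∘ (inside ∷_) ∘ ∁)) _ ⟩
  ∑ₛ (g ∘ (outside ∷_) ∘ ∁) + ∑ₛ (g ∘ (inside ∷_) ∘ ∁) ≡⟨ ∑ₛ-suc (g ∘ ∁) ⟨
  ∑ₛ (g ∘ ∁)                                           ∎
  where open ≡-Reasoning

∑ₛ-empty : (g : Subset m → ℕ) → (∀ S → ∣ S ∣ ≢ 0 → g S ≡ 0) → ∑ₛ g ≡ g ⊥
∑ₛ-empty {zero}  g _ = ℕ.+-identityʳ _
∑ₛ-empty {suc m} g g≡0 = trans (∑ₛ-suc g)
  (cong₂ _+_ (∑ₛ-zero _ λ S → g≡0 (inside ∷ S) λ ()) (∑ₛ-empty _ λ S → g≡0 (outside ∷ S)))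

-- With the first vertex inside, only an empty rest gives size 1, which is the term at `zero`; with
-- it outside, the recursion yields the other terms.
∑ₛ-singletons : (g : Subset m → ℕ) → (∀ S → ∣ S ∣ ≢ 1 → g S ≡ 0) → ∑ₛ g ≡ sum (g ∘ ⁅_⁆)
∑ₛ-singletons {zero}  g g≡0 = trans (ℕ.+-identityʳ _) (g≡0 [] λ ())
∑ₛ-singletons {suc m} g g≡0 = trans (∑ₛ-suc g)
  (cong₂ _+_ (∑ₛ-empty _ λ S ∣S∣≢0 → g≡0 (inside ∷ S) (∣S∣≢0 ∘ ℕ.suc-injective))
             (∑ₛ-singletons _ λ S → g≡0 (outside ∷ S)))

∁-involutive : (S : Subset m) → ∁ (∁ S) ≡ S
∁-involutive S = trans (sym (Vec.map-∘ _ _ S)) (trans (Vec.map-cong not-involutive S) (Vec.map-id S))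

∣∁∣-cancel : (S : Subset m) {k : ℕ} → k ≤ m → ∣ ∁ S ∣ ≡ m ∸ k → ∣ S ∣ ≡ k
∣∁∣-cancel {m} S k≤m eq = ℕ.∸-cancelˡ-≡ (∣p∣≤n S) k≤m (trans (sym (∣∁p∣≡n∸∣p∣ S)) eq)

-- Coefficients of `da` as numbers of sets

module _ {m : ℕ} (G : Graph (Fin m)) where
  open Graph G

  Admissible : Subset m → Set
  Admissible S = Nonempty S × Connected (induced G S)

  admissible? : Decidable Admissible
  admissible? S = nonempty? S ×-dec connected? G S

  Contributes : (k j : ℕ) → Subset m → Set
  Contributes k j S = Admissible S × (∣ S ∣ ≡ k × f-y G S ≡ j)

  contributes? : ∀ k j → Decidable (Contributes k j)
  contributes? k j S = admissible? S ×-dec ((∣ S ∣ ℕ.≟ k) ×-dec (f-y G S ℕ.≟ j))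

  coeff-da : ∀ k j → Y.coeff j ([x^ k ] da G) ≡ ∑ₛ (λ S → ⟦ contributes? k j S ⟧)
  coeff-da k j = begin
    Y.coeff j ([x^ k ] da G)
      ≡⟨ coeff-sum j k _ (connectedSubsets G) ⟩
    sumᴸ (map (λ S → Y.coeff j ([x^ k ] XY.monomial (1 ·y^ f-y G S) ∣ S ∣)) (connectedSubsets G))
      ≡⟨ cong sumᴸ (List.map-cong (λ S → coeff-x^·y^ j k (f-y G S) ∣ S ∣) (connectedSubsets G)) ⟩
    sumᴸ (map (λ S → ⟦ (∣ S ∣ ℕ.≟ k) ×-dec (f-y G S ℕ.≟ j) ⟧) (connectedSubsets G))
      ≡⟨ sum-filter admissible? (λ S → (∣ S ∣ ℕ.≟ k) ×-dec (f-y G S ℕ.≟ j)) (subsets m) ⟩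
    ∑ₛ (λ S → ⟦ contributes? k j S ⟧) ∎
    where open ≡-Reasoning

  -- This is `Contributes` without the size condition, which singletons, their complements and the
  -- full set meet by construction.
  Counted : ℕ → Subset m → Set
  Counted j S = Admissible S × f-y G S ≡ j

  counted? : ∀ j → Decidable (Counted j)
  counted? j S = admissible? S ×-dec (f-y G S ℕ.≟ j)

  contributes⇔counted : ∀ {k j S} → ∣ S ∣ ≡ k → Contributes k j S ⇔ Counted j S
  contributes⇔counted ∣S∣≡k = mk⇔ (λ (ad , _ , fy) → ad , fy) (λ (ad , fy) → ad , ∣S∣≡k , fy)

  wrong-size : ∀ {k j S} → ∣ S ∣ ≢ k → ⟦ contributes? k j S ⟧ ≡ 0
  wrong-size {k} {j} {S} ∣S∣≢k = ⟦⟧-false (contributes? k j S) (∣S∣≢k ∘ proj₁ ∘ proj₂)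

  coeff-singletons : ∀ j → Y.coeff j ([x^ 1 ] da G) ≡ count (λ v → counted? j ⁅ v ⁆)
  coeff-singletons j = trans (coeff-da 1 j) (trans (∑ₛ-singletons _ λ S → wrong-size {1} {j} {S})
    (count-cong (λ v → contributes? 1 j ⁅ v ⁆) (λ v → counted? j ⁅ v ⁆) λ v →
      contributes⇔counted (∣⁅x⁆∣≡1 v)))

  -- After complementation the relevant `S` are those with `∁ S` of size `m ∸ 1`. By `1 ≤ m` this
  -- subtraction is exact, so they are the singletons.
  coeff-co-singletons : 1 ≤ m → ∀ j → Y.coeff j ([x^ m ∸ 1 ] da G) ≡ count (λ v → counted? j (∁ ⁅ v ⁆))
  coeff-co-singletons 1≤m j = trans (coeff-da (m ∸ 1) j) (trans (∑ₛ-∁ (λ S → ⟦ contributes? (m ∸ 1) j S ⟧))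
    (trans (∑ₛ-singletons _ λ S ∣S∣≢1 → wrong-size {m ∸ 1} {j} {∁ S} (∣S∣≢1 ∘ ∣∁∣-cancel S 1≤m))
    (count-cong (λ v → contributes? (m ∸ 1) j (∁ ⁅ v ⁆)) (λ v → counted? j (∁ ⁅ v ⁆)) λ v →
      contributes⇔counted (trans (∣∁p∣≡n∸∣p∣ ⁅ v ⁆) (cong (m ∸_) (∣⁅x⁆∣≡1 v))))))

  coeff-full : ∀ j → Y.coeff j ([x^ m ] da G) ≡ ⟦ counted? j (∁ ⊥) ⟧
  coeff-full j = trans (coeff-da m j) (trans (∑ₛ-∁ (λ S → ⟦ contributes? m j S ⟧))
    (trans (∑ₛ-empty _ λ S ∣S∣≢0 → wrong-size {m} {j} {∁ S} (∣S∣≢0 ∘ ∣∁∣-cancel S z≤n))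
    (⟦⟧-cong (contributes⇔counted (trans (∣∁p∣≡n∸∣p∣ (⊥ {m})) (cong (m ∸_) (∣⊥∣≡0 m))))
      (contributes? m j (∁ ⊥)) (counted? j (∁ ⊥)))))

  -- A minimum is a lower bound that is attained. That `u` occurs in `elements S` also excludes the
  -- empty list, on which `minimum` has a dummy value.
  f-y-≡ : ∀ {S b} (u : Fin m) → u ∈ S → balance G S u ≡ b →
          (∀ {v} → v ∈ S → b ≤ balance G S v) → f-y G S ≡ b
  f-y-≡ {S} {b} u u∈S refl lower = attained (elements S) (elements-complete S (u , u∈S))
    where
    attained : ∀ xs → (u , u∈S) List.∈ xs → minimum (map (λ (v , _) → balance G S v) xs) ≡ b
    attained xs@((v , v∈S) ∷ xs′) u∈xs = ℕ.≤-antisym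
      (min≤v⁺ _ ys (above u∈xs))
      (v≤min⁺ (lower v∈S) (All.map⁺ (All.universal (λ (w , w∈S) → lower w∈S) xs′)))
      where
      ys = map (λ (v , _) → balance G S v) xs′
      above : (u , u∈S) List.∈ xs → balance G S v ≤ b ⊎ Any.Any (_≤ b) ys
      above (here refl) = inj₁ ℕ.≤-refl
      above (there u∈xs′) = inj₂ (Any.map (ℕ.≤-reflexive ∘ sym) (∈-map⁺ (λ (v , _) → balance G S v) u∈xs′))

  ∈-neighbours : ∀ u v → v ∈ neighbours G u ⇔ u ~ v
  ∈-neighbours u v = mk⇔
    (λ v∈N → ⟦⟧-proof (u ~? v) λ eq → ℕ.0≢1+n (trans (sym eq)
      (cong (if_then 1 else 0) (trans (sym (Vec.lookup∘tabulate _ v)) (Vec.[]=⇒lookup v∈N)))))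
    (λ u~v → Vec.lookup⇒[]= v _ (trans (Vec.lookup∘tabulate _ v) (dec-true (u ~? v) u~v)))

-- Degrees and balances

∣∣≡count : (S : Subset m) → ∣ S ∣ ≡ count (_∈? S)
∣∣≡count []            = refl
∣∣≡count (inside  ∷ S) = cong suc (∣∣≡count S)
∣∣≡count (outside ∷ S) = ∣∣≡count S

module _ {m : ℕ} (G : Graph (Fin m)) where
  open Graph G

  δ≡count : ∀ S u → δ G S u ≡ count (λ w → (w ∈? S) ×-dec (u ~? w))
  δ≡count S u = trans (∣∣≡count (S ∩ neighbours G u)) $
    count-cong (_∈? (S ∩ neighbours G u)) (λ w → (w ∈? S) ×-dec (u ~? w)) λ w → mk⇔
    (map₂ (Equivalence.to (∈-neighbours G u w)) ∘ x∈p∩q⁻ S (neighbours G u))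
    (x∈p∩q⁺ ∘ map₂ (Equivalence.from (∈-neighbours G u w)))

  -- A neighbour lies in exactly one of `S` and `∁ S`; thus `δ` has to be computed only for `⊥` and
  -- singletons.
  δ+δ∁≡deg : ∀ S u → δ G S u + δ G (∁ S) u ≡ deg G u
  δ+δ∁≡deg S u = trans (cong₂ _+_ (δ≡count S u) (δ≡count (∁ S) u)) $
    trans (sym (∑-distrib-+ (λ w → ⟦ (w ∈? S) ×-dec (u ~? w) ⟧) (λ w → ⟦ (w ∈? ∁ S) ×-dec (u ~? w) ⟧))) $
    sum-cong-≗ split
    where
    split : ∀ w → ⟦ (w ∈? S) ×-dec (u ~? w) ⟧ + ⟦ (w ∈? ∁ S) ×-dec (u ~? w) ⟧ ≡ ⟦ u ~? w ⟧
    split w with u ~? w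
    ... | no ¬u~w = cong₂ _+_
      (⟦⟧-false ((w ∈? S) ×-dec no ¬u~w) (¬u~w ∘ proj₂))
      (⟦⟧-false ((w ∈? ∁ S) ×-dec no ¬u~w) (¬u~w ∘ proj₂))
    ... | yes u~w with w ∈? S
    ...   | yes w∈S = cong suc (⟦⟧-false ((w ∈? ∁ S) ×-dec yes u~w) (x∈p⇒x∉∁p w∈S ∘ proj₁))
    ...   | no w∉S  = ⟦⟧-true ((w ∈? ∁ S) ×-dec yes u~w) (x∉p⇒x∈∁p w∉S , u~w)

  δ-⊥ : ∀ u → δ G ⊥ u ≡ 0
  δ-⊥ u = trans (δ≡count ⊥ u) (count-none (λ w → (w ∈? ⊥) ×-dec (u ~? w)) λ w → ∉⊥ ∘ proj₁)

  δ-singleton : ∀ v u → δ G ⁅ v ⁆ u ≡ ⟦ u ~? v ⟧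
  δ-singleton v u = trans (δ≡count ⁅ v ⁆ u) $ trans
    (sum-single v λ w w≢v → ⟦⟧-false ((w ∈? ⁅ v ⁆) ×-dec (u ~? w)) (w≢v ∘ x∈⁅y⁆⇒x≡y v ∘ proj₁))
    (⟦⟧-cong (mk⇔ proj₂ (x∈⁅x⁆ v ,_)) ((v ∈? ⁅ v ⁆) ×-dec (u ~? v)) (u ~? v))

  balance-singleton : ∀ v → balance G ⁅ v ⁆ v ≡ m ∸ deg G v
  balance-singleton v = cong₂ (λ a b → (a + m) ∸ b) δ≡0
    (trans (cong (_+ δ G (∁ ⁅ v ⁆) v) (sym δ≡0)) (δ+δ∁≡deg ⁅ v ⁆ v))
    where
    δ≡0 : δ G ⁅ v ⁆ v ≡ 0
    δ≡0 = trans (δ-singleton v v) (⟦⟧-false (v ~? v) ~-irr)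

  balance-full : ∀ u → balance G (∁ ⊥) u ≡ deg G u + m
  balance-full u = cong₂ (λ a b → (a + m) ∸ b)
    (trans (cong (_+ δ G (∁ ⊥) u) (sym (δ-⊥ u))) (δ+δ∁≡deg ⊥ u))
    (trans (cong (λ S → δ G S u) (∁-involutive ⊥)) (δ-⊥ u))

  -- All neighbours of `u` except possibly `v` lie in `∁ ⁅ v ⁆`, and only `v` can lie outside. An
  -- edge to `v` therefore enters twice.
  balance-co-singleton : ∀ v u → balance G (∁ ⁅ v ⁆) u ≡ (deg G u ∸ ⟦ u ~? v ⟧ + m) ∸ ⟦ u ~? v ⟧
  balance-co-singleton v u = cong₂ (λ a b → (a + m) ∸ b)
    (trans (sym (ℕ.m+n∸m≡n (δ G ⁅ v ⁆ u) (δ G (∁ ⁅ v ⁆) u)))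
      (cong₂ _∸_ (δ+δ∁≡deg ⁅ v ⁆ u) (δ-singleton v u)))
    (trans (cong (λ S → δ G S u) (∁-involutive ⁅ v ⁆)) (δ-singleton v u))

  f-y-singleton : ∀ v → f-y G ⁅ v ⁆ ≡ m ∸ deg G v
  f-y-singleton v = f-y-≡ G v (x∈⁅x⁆ v) (balance-singleton v) λ u∈ →
    ℕ.≤-reflexive (trans (sym (balance-singleton v)) (cong (balance G ⁅ v ⁆) (sym (x∈⁅y⁆⇒x≡y v u∈))))

  admissible-singleton : ∀ v → Admissible G ⁅ v ⁆
  admissible-singleton v = (v , x∈⁅x⁆ v) , connected
    where
    -- Vertices of an induced graph carry membership proofs, so uniqueness has to cover these as
    -- well.
    ∈-singleton-unique : ∀ {k} (v : Fin k) (u w : ∃ (_∈ ⁅ v ⁆)) → u ≡ w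
    ∈-singleton-unique zero    (zero , Vec.here)    (zero , Vec.here)    = refl
    ∈-singleton-unique zero    (suc u , Vec.there p) _ = contradiction p ∉⊥
    ∈-singleton-unique zero    (zero , Vec.here)    (suc w , Vec.there q) = contradiction q ∉⊥
    ∈-singleton-unique (suc v) (suc u , Vec.there p) (suc w , Vec.there q)
      with refl ← ∈-singleton-unique v (u , p) (w , q) = refl
    connected : Connected (induced G ⁅ v ⁆)
    connected u w with refl ← ∈-singleton-unique v u w = ε

  -- Singletons are always admissible, so this coefficient is the histogram of the values
  -- `m ∸ deg G v`.
  coeff-x : ∀ j → Y.coeff j ([x^ 1 ] da G) ≡ count (λ v → m ∸ deg G v ℕ.≟ j)
  coeff-x j = trans (coeff-singletons G j) $
    count-cong (λ v → counted? G j ⁅ v ⁆) (λ v → m ∸ deg G v ℕ.≟ j) λ v → mk⇔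
    (λ (_ , fy≡j) → trans (sym (f-y-singleton v)) fy≡j)
    (λ eq → admissible-singleton v , trans (f-y-singleton v) eq)

-- Wheels

≅-sym : ∀ {V W} {G : Graph V} {H : Graph W} → G ≅ H → H ≅ G
≅-sym {G = G} {H} G≅H = record
  { bijection = ↔-sym bijection
  ; adjacency = λ x y → subst₂ (λ x′ y′ → (x′ H.~ y′) ⇔ (from x G.~ from y))
      (Inverse.strictlyInverseˡ bijection x) (Inverse.strictlyInverseˡ bijection y)
      (⇔-sym (adjacency (from x) (from y)))
  }
  where
  open _≅_ G≅H
  module G = Graph G
  module H = Graph H

-- Degrees and connectedness of the cycle

module _ (n : ℕ) (n≥3 : 3 ≤ n) where
  private
    0<n : 0 < n
    0<n = ℕ.≤-trans (s≤s z≤n) n≥3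

  next-exists : ∀ i → ∃ λ j → Next n i j
  next-exists i with ℕ.m≤n⇒m<n∨m≡n (toℕ<n i)
  ... | inj₁ 1+i<n = fromℕ< 1+i<n , inj₁ (toℕ-fromℕ< 1+i<n)
  ... | inj₂ 1+i≡n = fromℕ< 0<n , inj₂ (1+i≡n , toℕ-fromℕ< 0<n)

  next-functional : ∀ {i j k} → Next n i j → Next n i k → j ≡ k
  next-functional (inj₁ j≡) (inj₁ k≡) = toℕ-injective (trans j≡ (sym k≡))
  next-functional (inj₂ (_ , j≡0)) (inj₂ (_ , k≡0)) = toℕ-injective (trans j≡0 (sym k≡0))
  next-functional {j = j} (inj₁ j≡) (inj₂ (1+i≡n , _)) = contradiction (trans j≡ 1+i≡n) (ℕ.<⇒≢ (toℕ<n j))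
  next-functional {k = k} (inj₂ (1+i≡n , _)) (inj₁ k≡) = contradiction (trans k≡ 1+i≡n) (ℕ.<⇒≢ (toℕ<n k))

  previous-exists : ∀ i → ∃ λ j → Next n j i
  previous-exists i with toℕ i in eq
  ... | zero  = let k , 1+k≡n = ℕ.m≤n⇒∃[o]m+o≡n 0<n ; k<n = ℕ.≤-reflexive 1+k≡n
                in fromℕ< k<n , inj₂ (trans (cong suc (toℕ-fromℕ< k<n)) 1+k≡n , refl)
  ... | suc k = let k<n = ℕ.<⇒≤ (subst (_< n) eq (toℕ<n i))
                in fromℕ< k<n , inj₁ (cong suc (sym (toℕ-fromℕ< k<n)))

  next-injective : ∀ {i j k} → Next n j i → Next n k i → j ≡ k
  next-injective (inj₁ i≡1+j) (inj₁ i≡1+k) = toℕ-injective (ℕ.suc-injective (trans (sym i≡1+j) i≡1+k))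
  next-injective (inj₂ (1+j≡n , _)) (inj₂ (1+k≡n , _)) =
    toℕ-injective (ℕ.suc-injective (trans 1+j≡n (sym 1+k≡n)))
  next-injective (inj₁ i≡1+j) (inj₂ (_ , i≡0)) = contradiction (trans (sym i≡0) i≡1+j) ℕ.0≢1+n
  next-injective (inj₂ (_ , i≡0)) (inj₁ i≡1+k) = contradiction (trans (sym i≡0) i≡1+k) ℕ.0≢1+n

  -- Without wrapping around, each index would be smaller than the other. One wrap would force `n`
  -- to be 2, and two wraps would force it to be 1.
  next-asym : ∀ {i j} → Next n i j → ¬ Next n j i
  next-asym (inj₁ j≡1+i) (inj₁ i≡1+j) =
    ℕ.<-asym (ℕ.≤-reflexive (sym j≡1+i)) (ℕ.≤-reflexive (sym i≡1+j))
  next-asym (inj₁ j≡1+i) (inj₂ (1+j≡n , i≡0)) =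
    ℕ.<⇒≢ n≥3 (trans (cong suc (sym (trans j≡1+i (cong suc i≡0)))) 1+j≡n)
  next-asym (inj₂ (1+i≡n , j≡0)) (inj₁ i≡1+j) =
    ℕ.<⇒≢ n≥3 (trans (cong suc (sym (trans i≡1+j (cong suc j≡0)))) 1+i≡n)
  next-asym (inj₂ (1+i≡n , j≡0)) (inj₂ (1+j≡n , i≡0)) =
    ℕ.<⇒≢ (ℕ.<⇒≤ n≥3) (trans (cong suc (sym i≡0)) 1+i≡n)

  -- One neighbour is the successor, the other the predecessor, and `next-asym` keeps them apart.
  deg-cycle : ∀ i → deg (cycle n n≥3) i ≡ 2
  deg-cycle i = trans
    (sum-cong-≗ λ j → ⟦⟧-⊎ (next? n i j) (next? n j i) λ (ij , ji) → next-asym ij ji)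
    (trans (∑-distrib-+ (λ j → ⟦ next? n i j ⟧) (λ j → ⟦ next? n j i ⟧)) (cong₂ _+_
      (let j , ij = next-exists i     in count-unique (next? n i)          j ij λ k ik → next-functional ik ij)
      (let j , ji = previous-exists i in count-unique (λ k → next? n k i) j ji λ k ki → next-injective ki ji)))

cycle-connected : ∀ n n≥3 → Connected (cycle n n≥3)
cycle-connected (suc n) n≥3 i j = reverse (Graph.~-sym C) (from-zero i) ◅◅ from-zero j
  where
  C = cycle (suc n) n≥3
  from-zero : ∀ i → Star (Graph._~_ C) zero i
  from-zero = <-weakInduction (Star (Graph._~_ C) zero) ε λ i path →
    path ◅◅ inj₁ (inj₁ (cong suc (sym (toℕ-inject₁ i)))) ◅ ε

-- The coefficients of the wheel

module WheelCoefficients (n : ℕ) (n≥3 : 3 ≤ n) (G : Graph (Fin (suc n)))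
                          (wheel≅G : wheel n n≥3 ≅ G) where
  open Graph G
  open _≅_ wheel≅G
  private
    Cₙ = cycle n n≥3
    module Cₙ = Graph Cₙ

  hub : Fin (suc n)
  hub = to (inj₂ tt)

  rim : Fin n → Fin (suc n)
  rim i = to (inj₁ i)

  -- A view that turns the surjectivity of `to` into case analysis.
  data Vertex : Fin (suc n) → Set where
    is-hub : Vertex hub
    is-rim : ∀ i → Vertex (rim i)

  vertex : ∀ v → Vertex v
  vertex v = subst Vertex (Inverse.strictlyInverseˡ bijection v) (image (from v))
    where
    image : ∀ x → Vertex (to x)
    image (inj₁ i)  = is-rim i
    image (inj₂ tt) = is-hub

  hub~rim : ∀ i → hub ~ rim i
  hub~rim i = Equivalence.to (adjacency (inj₂ tt) (inj₁ i)) tt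

  rim~rim : ∀ i j → i Cₙ.~ j ⇔ rim i ~ rim j
  rim~rim i j = adjacency (inj₁ i) (inj₁ j)

  -- The sum is taken along the permutation that sends `zero` to `hub` and `suc i` to `rim i`.
  sum-vertices : ∀ t → sum t ≡ t hub + sum (t ∘ rim)
  sum-vertices t = sum-permute t (mk↔ₛ′ enum index enum-index index-enum)
    where
    enum : Fin (suc n) → Fin (suc n)
    enum zero    = hub
    enum (suc i) = rim i
    index′ : Fin n ⊎ ⊤ → Fin (suc n)
    index′ (inj₁ i) = suc i
    index′ (inj₂ _) = zero
    index : Fin (suc n) → Fin (suc n)
    index v = index′ (from v)
    enum-index : ∀ v → enum (index v) ≡ v
    enum-index v = trans (lemma (from v)) (Inverse.strictlyInverseˡ bijection v)
      where
      lemma : ∀ x → enum (index′ x) ≡ to x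
      lemma (inj₁ i) = refl
      lemma (inj₂ _) = refl
    index-enum : ∀ i → index (enum i) ≡ i
    index-enum zero    = cong index′ (Inverse.strictlyInverseʳ bijection (inj₂ tt))
    index-enum (suc i) = cong index′ (Inverse.strictlyInverseʳ bijection (inj₁ i))

  count-vertices : {P : Fin (suc n) → Set} (P? : Decidable P) →
                   count P? ≡ ⟦ P? hub ⟧ + count (P? ∘ rim)
  count-vertices P? = sum-vertices λ v → ⟦ P? v ⟧

  deg-hub : deg G hub ≡ n
  deg-hub = trans (count-vertices (hub ~?_)) $ cong₂ _+_
    (⟦⟧-false (hub ~? hub) ~-irr) (count-all (λ i → hub ~? rim i) hub~rim)

  deg-rim : ∀ i → deg G (rim i) ≡ 3
  deg-rim i = trans (count-vertices (rim i ~?_)) $ cong₂ _+_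
    (⟦⟧-true (rim i ~? hub) (~-sym (hub~rim i)))
    (trans (count-cong (λ j → rim i ~? rim j) (i Cₙ.~?_) λ j → ⇔-sym (rim~rim i j)) (deg-cycle n n≥3 i))

  3≤deg : ∀ v → 3 ≤ deg G v
  3≤deg v with vertex v
  ... | is-hub   = ℕ.≤-trans n≥3 (ℕ.≤-reflexive (sym deg-hub))
  ... | is-rim i = ℕ.≤-reflexive (sym (deg-rim i))

  -- Provides the vertex at which the balance in `∁ ⁅ v ⁆` is least: it has degree 3 and loses an
  -- edge to `v`.
  rim-neighbour : ∀ v → ∃ λ i → rim i ~ v
  rim-neighbour v with vertex v
  ... | is-hub   = fromℕ< n≥3 , ~-sym (hub~rim _)
  ... | is-rim i = let j , ij = next-exists n n≥3 i in j , Equivalence.to (rim~rim j i) (inj₂ ij)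

  hub∈⇒connected : ∀ {S} → hub ∈ S → Connected (induced G S)
  hub∈⇒connected {S} h∈S u v = reverse ~-sym (from-hub u) ◅◅ from-hub v
    where
    from-hub : ∀ u → Star (Graph._~_ (induced G S)) (hub , h∈S) u
    from-hub (u , u∈S) with vertex u
    -- The two copies of the hub may carry different membership proofs, which `[]=-irrelevant`
    -- identifies.
    ... | is-hub   = subst (λ p → Star _ (hub , h∈S) (hub , p)) ([]=-irrelevant h∈S u∈S) ε
    ... | is-rim i = hub~rim i ◅ ε

  ∉⁅⁆⇒∈∁ : ∀ {u v : Fin (suc n)} → u ≢ v → u ∈ ∁ ⁅ v ⁆
  ∉⁅⁆⇒∈∁ {u} {v} u≢v = x∉p⇒x∈∁p (u≢v ∘ x∈⁅y⁆⇒x≡y v)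

  rim∈∁hub : ∀ i → rim i ∈ ∁ ⁅ hub ⁆
  rim∈∁hub i = ∉⁅⁆⇒∈∁ λ eq → ~-irr (subst (hub ~_) eq (hub~rim i))

  rim-connected : Connected (induced G (∁ ⁅ hub ⁆))
  rim-connected (u , u∈) (v , v∈) with vertex u | vertex v
  ... | is-hub   | _        = contradiction (x∈⁅x⁆ hub) (x∈∁p⇒x∉p u∈)
  ... | is-rim _ | is-hub   = contradiction (x∈⁅x⁆ hub) (x∈∁p⇒x∉p v∈)
  ... | is-rim i | is-rim j = subst₂ (λ p q → Star _ (rim i , p) (rim j , q))
    ([]=-irrelevant _ u∈) ([]=-irrelevant _ v∈)
    (gmap (λ k → rim k , rim∈∁hub k) (λ {k} {l} → Equivalence.to (rim~rim k l)) (cycle-connected n n≥3 i j))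

  admissible-co-singleton : ∀ v → Admissible G (∁ ⁅ v ⁆)
  admissible-co-singleton v with vertex v
  ... | is-hub   = (_ , rim∈∁hub (fromℕ< n≥3)) , rim-connected
  ... | is-rim i = (hub , hub∈) , hub∈⇒connected hub∈
    where
    hub∈ : hub ∈ ∁ ⁅ rim i ⁆
    hub∈ = ∉⁅⁆⇒∈∁ λ eq → ~-irr (subst (_~ rim i) eq (hub~rim i))

  -- As degrees are at least 3 and brackets at most 1, each balance is at least
  -- `(3 ∸ 1 + suc n) ∸ 1`, that is `n + 2`; the rim neighbour of `v` attains it.
  f-y-co-singleton : ∀ v → f-y G (∁ ⁅ v ⁆) ≡ n + 2
  f-y-co-singleton v with rim-neighbour v
  ... | i , i~v = f-y-≡ G (rim i) (∉⁅⁆⇒∈∁ λ eq → ~-irr (subst (_~ v) eq i~v)) attained λ {u} _ → lower u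
    where
    attained : balance G (∁ ⁅ v ⁆) (rim i) ≡ n + 2
    attained rewrite balance-co-singleton G v (rim i) | deg-rim i | ⟦⟧-true (rim i ~? v) i~v = ℕ.+-comm 2 n
    lower : ∀ u → n + 2 ≤ balance G (∁ ⁅ v ⁆) u
    lower u rewrite balance-co-singleton G v u | ℕ.+-comm n 2 =
      ℕ.∸-mono (ℕ.+-monoˡ-≤ (suc n) (ℕ.∸-mono (3≤deg u) (⟦⟧≤1 (u ~? v)))) (⟦⟧≤1 (u ~? v))

  admissible-full : Admissible G (∁ ⊥)
  admissible-full = (hub , x∉p⇒x∈∁p ∉⊥) , hub∈⇒connected (x∉p⇒x∈∁p ∉⊥)

  -- The balance is `deg G u + suc n` here, and any rim vertex has the least degree 3.
  f-y-full : f-y G (∁ ⊥) ≡ n + 4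
  f-y-full = f-y-≡ G (rim (fromℕ< n≥3)) (x∉p⇒x∈∁p ∉⊥) attained λ {u} _ → lower u
    where
    attained : balance G (∁ ⊥) (rim (fromℕ< n≥3)) ≡ n + 4
    attained rewrite balance-full G (rim (fromℕ< n≥3)) | deg-rim (fromℕ< n≥3) = ℕ.+-comm 4 n
    lower : ∀ u → n + 4 ≤ balance G (∁ ⊥) u
    lower u rewrite balance-full G u | ℕ.+-comm n 4 = ℕ.+-monoˡ-≤ (suc n) (3≤deg u)

  coeff-1 : [x^ 1 ] da G ≈ n ·y^ (n ∸ 2) ⊕ 1 ·y^ 1
  coeff-1 j = begin
    Y.coeff j ([x^ 1 ] da G)                                ≡⟨ coeff-x G j ⟩
    count (λ v → suc n ∸ deg G v ℕ.≟ j)                      ≡⟨ count-vertices (λ v → suc n ∸ deg G v ℕ.≟ j) ⟩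
    ⟦ suc n ∸ deg G hub ℕ.≟ j ⟧ + count (λ i → suc n ∸ deg G (rim i) ℕ.≟ j)
      -- The hub has exponent `suc n ∸ n`, that is 1; a rim vertex has `suc n ∸ 3`, which reduces to
      -- `n ∸ 2`.
      ≡⟨ cong₂ _+_ (cong (λ d → ⟦ d ℕ.≟ j ⟧) (trans (cong (suc n ∸_) deg-hub) (ℕ.m+n∸n≡m 1 n)))
                   (sum-const λ i → cong (λ d → ⟦ suc n ∸ d ℕ.≟ j ⟧) (deg-rim i)) ⟩
    ⟦ 1 ℕ.≟ j ⟧ + n * ⟦ n ∸ 2 ℕ.≟ j ⟧                        ≡⟨ ℕ.+-comm ⟦ 1 ℕ.≟ j ⟧ _ ⟩
    n * ⟦ n ∸ 2 ℕ.≟ j ⟧ + ⟦ 1 ℕ.≟ j ⟧                        ≡⟨ coeff-binomial n (n ∸ 2) 1 j ⟨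
    Y.coeff j (n ·y^ (n ∸ 2) ⊕ 1 ·y^ 1)                      ∎
    where open ≡-Reasoning

  ⟦counted⟧ : ∀ j {S} {b} → Admissible G S → f-y G S ≡ b → ⟦ counted? G j S ⟧ ≡ ⟦ b ℕ.≟ j ⟧
  ⟦counted⟧ j {S} {b} admissible refl = ⟦⟧-cong (mk⇔ proj₂ (admissible ,_)) (counted? G j S) (b ℕ.≟ j)

  coeff-n : [x^ n ] da G ≈ suc n ·y^ (n + 2)
  coeff-n j = begin
    Y.coeff j ([x^ n ] da G)              ≡⟨ coeff-co-singletons G (s≤s z≤n) j ⟩
    count (λ v → counted? G j (∁ ⁅ v ⁆))
      ≡⟨ sum-const (λ v → ⟦counted⟧ j (admissible-co-singleton v) (f-y-co-singleton v)) ⟩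
    suc n * ⟦ n + 2 ℕ.≟ j ⟧               ≡⟨ coeff-·y^ j (suc n) (n + 2) ⟨
    Y.coeff j (suc n ·y^ (n + 2))         ∎
    where open ≡-Reasoning

  coeff-1+n : [x^ suc n ] da G ≈ 1 ·y^ (n + 4)
  coeff-1+n j = begin
    Y.coeff j ([x^ suc n ] da G) ≡⟨ coeff-full G j ⟩
    ⟦ counted? G j (∁ ⊥) ⟧       ≡⟨ ⟦counted⟧ j admissible-full f-y-full ⟩
    ⟦ n + 4 ℕ.≟ j ⟧              ≡⟨ ℕ.*-identityˡ _ ⟨
    1 * ⟦ n + 4 ℕ.≟ j ⟧          ≡⟨ coeff-·y^ j 1 (n + 4) ⟨
    Y.coeff j (1 ·y^ (n + 4))    ∎
    where open ≡-Reasoning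

-- Removing one index of value b first leaves a constant family, so b = c needs no separate
-- treatment; this occurs for n = 3, where the wheel is K₄.
two-values : (a : Fin m → ℕ) (b c : ℕ) →
             (∀ j → count (λ v → a v ℕ.≟ j) ≡ n * ⟦ c ℕ.≟ j ⟧ + ⟦ b ℕ.≟ j ⟧) →
             m ≡ suc n × ∃ λ h → a h ≡ b × ∀ v → v ≢ h → a v ≡ c
two-values {m} {n} a b c histogram with count≢0⇒ (λ v → a v ℕ.≟ b) (λ eq →
  ℕ.1+n≢0 (trans (sym (⟦⟧-true (b ℕ.≟ b) refl)) (ℕ.m+n≡0⇒n≡0 (n * ⟦ c ℕ.≟ b ⟧) (trans (sym (histogram b)) eq))))
two-values {suc m} {n} a b c histogram | h , ah≡b = cong suc m≡n , h , ah≡b , others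
  where
  rest : ∀ j → count (λ k → a (punchIn h k) ℕ.≟ j) ≡ n * ⟦ c ℕ.≟ j ⟧
  rest j = ℕ.+-cancelˡ-≡ ⟦ b ℕ.≟ j ⟧ _ _ (begin
    ⟦ b ℕ.≟ j ⟧ + count (λ k → a (punchIn h k) ℕ.≟ j)
      ≡⟨ cong (λ x → ⟦ x ℕ.≟ j ⟧ + count (λ k → a (punchIn h k) ℕ.≟ j)) ah≡b ⟨
    ⟦ a h ℕ.≟ j ⟧ + count (λ k → a (punchIn h k) ℕ.≟ j)
      ≡⟨ sum-remove {i = h} (λ v → ⟦ a v ℕ.≟ j ⟧) ⟨
    count (λ v → a v ℕ.≟ j)
      ≡⟨ histogram j ⟩
    n * ⟦ c ℕ.≟ j ⟧ + ⟦ b ℕ.≟ j ⟧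
      ≡⟨ ℕ.+-comm (n * ⟦ c ℕ.≟ j ⟧) _ ⟩
    ⟦ b ℕ.≟ j ⟧ + n * ⟦ c ℕ.≟ j ⟧ ∎)
    where open ≡-Reasoning

  -- The histogram is read at the very value in question. The count there is not 0, whereas the
  -- right-hand side vanishes unless the value is `c`.
  rest-value : ∀ k → a (punchIn h k) ≡ c
  rest-value k = sym $ ⟦⟧-proof (c ℕ.≟ a (punchIn h k)) λ ⟦⟧≡0 →
    count≡0⇒ (λ l → a (punchIn h l) ℕ.≟ a (punchIn h k))
      (trans (rest (a (punchIn h k))) (trans (cong (n *_) ⟦⟧≡0) (ℕ.*-zeroʳ n))) k refl

  others : ∀ v → v ≢ h → a v ≡ c
  others v v≢h with k , refl ← punchIn-surjective h v≢h = rest-value k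

  m≡n : m ≡ n
  m≡n = begin
    m                                      ≡⟨ count-all (λ k → a (punchIn h k) ℕ.≟ c) rest-value ⟨
    count (λ k → a (punchIn h k) ℕ.≟ c)    ≡⟨ rest c ⟩
    n * ⟦ c ℕ.≟ c ⟧                         ≡⟨ cong (n *_) (⟦⟧-true (c ℕ.≟ c) refl) ⟩
    n * 1                                  ≡⟨ ℕ.*-identityʳ n ⟩
    n                                      ∎
    where open ≡-Reasoning

-- Rebuilding the wheel from its hub

delete : Graph (Fin (suc n)) → Fin (suc n) → Graph (Fin n)
delete G h = record
  { _~_   = λ i j → punchIn h i ~ punchIn h j
  ; _~?_  = λ i j → punchIn h i ~? punchIn h j
  ; ~-sym = ~-sym
  ; ~-irr = ~-irr
  }
  where open Graph G

-- The induced graph has pairs as vertices, whereas `delete` has `Fin n`, as `2-regular⇒cycle`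
-- requires. Paths are carried over by `index`, a left inverse of `kept`.
delete-connected : (G : Graph (Fin (suc n))) (h : Fin (suc n)) →
                   Connected (induced G (∁ ⁅ h ⁆)) → Connected (delete G h)
delete-connected {n} G h connected i j =
  subst₂ (Star (Graph._~_ (delete G h))) (index-kept i) (index-kept j)
    (gmap index (λ {u} {v} → subst₂ (Graph._~_ G) (sym (proj₂ (position u))) (sym (proj₂ (position v))))
      (connected (kept i) (kept j)))
  where
  kept : Fin n → ∃ (_∈ ∁ ⁅ h ⁆)
  kept i = punchIn h i , x∉p⇒x∈∁p (punchInᵢ≢i h i ∘ x∈⁅y⁆⇒x≡y h)

  position : (u : ∃ (_∈ ∁ ⁅ h ⁆)) → ∃ λ k → punchIn h k ≡ proj₁ u
  position (u , u∈) = punchIn-surjective h λ { refl → x∈∁p⇒x∉p u∈ (x∈⁅x⁆ h) }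

  index : ∃ (_∈ ∁ ⁅ h ⁆) → Fin n
  index = proj₁ ∘ position

  index-kept : ∀ i → index (kept i) ≡ i
  index-kept i = punchIn-injective h _ _ (proj₂ (position (kept i)))

deg-delete : (G : Graph (Fin (suc n))) (h : Fin (suc n)) (i : Fin n) {k : ℕ} →
             Graph._~_ G (punchIn h i) h → deg G (punchIn h i) ≡ suc k → deg (delete G h) i ≡ k
deg-delete G h i = count-punchIn (Graph._~?_ G (punchIn h i)) h

join-K₁≅ : {W : Set} (C : Graph W) (G : Graph (Fin (suc n))) (h : Fin (suc n)) →
           (∀ i → Graph._~_ G h (punchIn h i)) → C ≅ delete G h → join C K₁ ≅ G
join-K₁≅ {n} {W} C G h h~ C≅ = record
  { bijection = mk↔ₛ′ to from to-from from-to
  ; adjacency = adjacency′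
  }
  where
  open Graph G
  module C≅ = _≅_ C≅
  open Inverse C≅.bijection using (strictlyInverseˡ; strictlyInverseʳ)

  to : W ⊎ ⊤ → Fin (suc n)
  to (inj₁ w) = punchIn h (C≅.to w)
  to (inj₂ _) = h

  from : Fin (suc n) → W ⊎ ⊤
  from v with v ≟ h
  ... | yes _  = inj₂ tt
  ... | no v≢h = inj₁ (C≅.from (proj₁ (punchIn-surjective h v≢h)))

  to-from : ∀ v → to (from v) ≡ v
  to-from v with v ≟ h
  ... | yes v≡h = sym v≡h
  ... | no v≢h  = trans (cong (punchIn h) (strictlyInverseˡ _)) (proj₂ (punchIn-surjective h v≢h))

  from-to : ∀ x → from (to x) ≡ x
  from-to (inj₁ w) with punchIn h (C≅.to w) ≟ h
  ... | yes eq = contradiction eq (punchInᵢ≢i h (C≅.to w))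
  ... | no neq = cong inj₁ (trans
    (cong C≅.from (punchIn-injective h _ _ (proj₂ (punchIn-surjective h neq))))
    (strictlyInverseʳ w))
  from-to (inj₂ _) with h ≟ h
  ... | yes _  = refl
  ... | no h≢h = contradiction refl h≢h

  adjacency′ : ∀ x y → JoinAdj C K₁ x y ⇔ (to x ~ to y)
  adjacency′ (inj₁ x) (inj₁ y) = C≅.adjacency x y
  adjacency′ (inj₁ x) (inj₂ _) = mk⇔ (λ _ → ~-sym (h~ (C≅.to x))) _
  adjacency′ (inj₂ _) (inj₁ y) = mk⇔ (λ _ → h~ (C≅.to y)) _
  adjacency′ (inj₂ _) (inj₂ _) = mk⇔ (λ ()) ~-irr

-- `Fin n ⊎ ⊤` is in bijection with `Fin (n + 1)`, and finite types in bijection have equal size.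
wheel-order : {G : Graph (Fin m)} {n≥3 : 3 ≤ n} → G ≅ wheel n n≥3 → m ≡ suc n
wheel-order {m} {n} G≅W = trans
  (Permutation.↔⇒≡ (↔-trans (_≅_.bijection G≅W) (↔-trans (↔-id _ ⊎-↔ ↔-sym 1↔⊤) (↔-sym +↔⊎))))
  (ℕ.+-comm n 1)

-- The hypotheses on `h` and on the other vertices are what `two-values` extracts from the
-- coefficient of x.
module WheelReconstruction (n : ℕ) (n≥3 : 3 ≤ n) (G : Graph (Fin (suc n))) (h : Fin (suc n))
  (h-value : suc n ∸ deg G h ≡ 1) (other-values : ∀ v → v ≢ h → suc n ∸ deg G v ≡ n ∸ 2)
  (coeff-n : [x^ n ] da G ≈ suc n ·y^ (n + 2)) where
  open Graph G

  -- The values `suc n ∸ deg G v` determine the degrees only in the absence of truncation, which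
  -- this bound ensures.
  deg≤ : ∀ v → deg G v ≤ suc n
  deg≤ v = sum-bounded (λ w → ⟦⟧≤1 (v ~? w))

  deg-h : deg G h ≡ n
  deg-h = ℕ.∸-cancelˡ-≡ (deg≤ h) (ℕ.n≤1+n n) (trans h-value (sym (ℕ.m+n∸n≡m 1 n)))

  deg-other : ∀ i → deg G (punchIn h i) ≡ 3
  deg-other i = ℕ.∸-cancelˡ-≡ (deg≤ _) (ℕ.m≤n⇒m≤1+n n≥3) (other-values _ (punchInᵢ≢i h i))

  -- Since `h` is not adjacent to itself, its degree `n` is spread over the `n` other vertices, so
  -- each of them counts.
  h~ : ∀ i → h ~ punchIn h i
  h~ = count-full⇒ (λ i → h ~? punchIn h i) (begin
    count (λ i → h ~? punchIn h i)
      ≡⟨ cong (_+ count (λ i → h ~? punchIn h i)) (⟦⟧-false (h ~? h) ~-irr) ⟨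
    ⟦ h ~? h ⟧ + count (λ i → h ~? punchIn h i) ≡⟨ sum-remove {i = h} (λ v → ⟦ h ~? v ⟧) ⟨
    deg G h                                      ≡⟨ deg-h ⟩
    n                                            ∎)
    where open ≡-Reasoning

  -- The coefficient `suc n` equals the number of vertices, so no complement of a vertex fails to
  -- count. For `h` this includes the connectedness of the graph that remains.
  co-singletons-counted : ∀ v → Counted G (n + 2) (∁ ⁅ v ⁆)
  co-singletons-counted = count-full⇒ (λ v → counted? G (n + 2) (∁ ⁅ v ⁆)) (begin
    count (λ v → counted? G (n + 2) (∁ ⁅ v ⁆))  ≡⟨ coeff-co-singletons G (s≤s z≤n) (n + 2) ⟨
    Y.coeff (n + 2) ([x^ n ] da G)               ≡⟨ coeff-n (n + 2) ⟩
    Y.coeff (n + 2) (suc n ·y^ (n + 2))          ≡⟨ coeff-·y^ (n + 2) (suc n) (n + 2) ⟩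
    suc n * ⟦ n + 2 ℕ.≟ n + 2 ⟧                  ≡⟨ cong (suc n *_) (⟦⟧-true (n + 2 ℕ.≟ n + 2) refl) ⟩
    suc n * 1                                    ≡⟨ ℕ.*-identityʳ (suc n) ⟩
    suc n                                        ∎)
    where open ≡-Reasoning

  -- Each remaining vertex loses its edge to `h`, so its degree drops from 3 to 2.
  delete≅cycle : delete G h ≅ cycle n n≥3
  delete≅cycle = 2-regular⇒cycle n≥3 (delete G h)
    (λ i → deg-delete G h i (~-sym (h~ i)) (deg-other i))
    (delete-connected G h (proj₂ (proj₁ (co-singletons-counted h))))

  G≅wheel : G ≅ wheel n n≥3
  G≅wheel = ≅-sym (join-K₁≅ (cycle n n≥3) G h h~ (≅-sym delete≅cycle))

proposition32 : (n : ℕ) (n≥3 : 3 ≤ n) (m : ℕ) .{{_ : NonZero m}} (G : Graph (Fin m)) →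
    (G ≅ wheel n n≥3) ⇔
    ( ([x^ 1 ] da G ≈ n ·y^ (n ∸ 2) ⊕ 1 ·y^ 1)
    × ([x^ n ] da G ≈ (n + 1) ·y^ (n + 2))
    × ([x^ (n + 1) ] da G ≈ 1 ·y^ (n + 4)) )
proposition32 n n≥3 m G rewrite ℕ.+-comm n 1 = mk⇔ coefficients reconstruct
  where
  coefficients : G ≅ wheel n n≥3 →
    ([x^ 1 ] da G ≈ n ·y^ (n ∸ 2) ⊕ 1 ·y^ 1) ×
    ([x^ n ] da G ≈ suc n ·y^ (n + 2)) × ([x^ suc n ] da G ≈ 1 ·y^ (n + 4))
  coefficients G≅W with refl ← wheel-order {n≥3 = n≥3} G≅W = coeff-1 , coeff-n , coeff-1+n
    where open WheelCoefficients n n≥3 G (≅-sym G≅W)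

  histogram : [x^ 1 ] da G ≈ n ·y^ (n ∸ 2) ⊕ 1 ·y^ 1 →
              ∀ j → count (λ v → m ∸ deg G v ℕ.≟ j) ≡ n * ⟦ n ∸ 2 ℕ.≟ j ⟧ + ⟦ 1 ℕ.≟ j ⟧
  histogram coeff-1 j = trans (sym (coeff-x G j)) (trans (coeff-1 j) (coeff-binomial n (n ∸ 2) 1 j))

  reconstruct :
    ([x^ 1 ] da G ≈ n ·y^ (n ∸ 2) ⊕ 1 ·y^ 1) ×
    ([x^ n ] da G ≈ suc n ·y^ (n + 2)) × ([x^ suc n ] da G ≈ 1 ·y^ (n + 4)) → G ≅ wheel n n≥3
  reconstruct (coeff-1 , coeff-n , _)
    -- The histogram fixes the order of `G` and supplies a hub through the value 1.
    with refl , h , h-value , other-values ←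
      two-values {n = n} (λ v → m ∸ deg G v) 1 (n ∸ 2) (histogram coeff-1)
    = WheelReconstruction.G≅wheel n n≥3 G h h-value other-values coeff-n
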